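{- Let $s\ge 2$ be an integer and let $\varepsilon>0$. Then there exists $n_0$ such that for every integer $n\ge n_0$ the following holds. If $G$ is a tripartite graph with three vertex classes each of size $n$ and minimum degree $$\delta(G)\ \ge\ n+(1+\varepsilon)(s-1)^{1/(3s^{2})}\,n^{1-1/(3s^{2})},$$ then $G$ contains a copy of $K_3(s)$.
   Context: A tripartite graph here has its vertex set partitioned into three classes $V_1,V_2,V_3$ with no edges inside any class. $K_3(s)$ denotes the complete tripartite graph with three classes of size $s$ each. "$G$ contains a copy of $H$" means $G$ has a subgraph isomorphic to $H$. -}

module Defs where

open import Data.Nat using (ℕ; zero; suc; _+_)
open import Data.Bool using (Bool; true; false; if_then_else_)
open import Data.Fin using (Fin; zero; suc)
open import Data.Product using (_×_; _,_)
open import Relation.Binary.PropositionalEquality using (_≡_; _≢_)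
open import Function.Definitions using (Injective)

-- Vertex set of a tripartite graph with three classes of size n:
-- vertex (i , j) is the j-th vertex of class V_(i+1).
Vtx : ℕ → Set
Vtx n = Fin 3 × Fin n

record TripartiteGraph (n : ℕ) : Set where
  field
    adj     : Vtx n → Vtx n → Bool
    sym     : ∀ u v → adj u v ≡ adj v u
    noIntra : ∀ i j j′ → adj (i , j) (i , j′) ≡ false
open TripartiteGraph public

countFin : (m : ℕ) → (Fin m → Bool) → ℕ
countFin zero    P = 0
countFin (suc m) P = (if P zero then 1 else 0) + countFin m (λ k → P (suc k))

sumFin : (m : ℕ) → (Fin m → ℕ) → ℕ
sumFin zero    f = 0
sumFin (suc m) f = f zero + sumFin m (λ k → f (suc k))

countVtx : (n : ℕ) → (Vtx n → Bool) → ℕ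
countVtx n P = sumFin 3 (λ i → countFin n (λ j → P (i , j)))

degree : ∀ {n} → TripartiteGraph n → Vtx n → ℕ
degree {n} G v = countVtx n (λ w → adj G v w)

ContainsK3 : ∀ {n} → (s : ℕ) → TripartiteGraph n → Set
ContainsK3 {n} s G =
  Data.Product.Σ (Fin 3 × Fin s → Vtx n) λ f →
    Injective _≡_ _≡_ f ×
    (∀ a b (x y : Fin s) → a ≢ b → adj G (f (a , x)) (f (b , y)) ≡ true)

{-# OPTIONS --safe #-}

-- Let t be the excess δ(G) − n of the minimum degree.
--
-- G has at least t³ triangles.  More generally, if Aᵢ ⊆ Vᵢ misses at most t − mᵢ
-- vertices, then at least m₁ m₂ m₃ triangles lie in A₁ ∪ A₂ ∪ A₃: take v ∈ A₁ whose degree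
-- into V₂ is not exceeded by the degree into V₁ of any w ∈ A₃.  Every edge vw with
-- w ∈ A₃ then has at least m₂ common neighbours in A₂, there are at least m₃ such
-- edges, and deleting v lowers m₁ by one.
--
-- Triangles form a 3-partite 3-graph on V₁ ∪ V₂ ∪ V₃, and t³ exceeds the box-theorem
-- threshold (s − 1)^(1/s²) n^(3 − 1/s²) by a factor of at least (1 + ε)³, which absorbs the lower
-- order terms of two successive Kővári–Sós–Turán arguments.
module Submission where

open import Defs renaming (sym to adj-sym)
open import Data.Bool using (Bool; true; false; _∧_; not; if_then_else_)
open import Data.Bool.Properties using (∧-comm; ∧-assoc; ∧-identityʳ) renaming (_≟_ to _≟ᵇ_)
open import Data.Fin using (Fin; zero; suc; punchIn; combine; quotient; remainder; _↑ˡ_; _↑ʳ_)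
open import Data.Fin.Patterns using (0F; 1F; 2F)
open import Data.Fin.Properties using (_≟_; any?; punchInᵢ≢i; remQuot-combine)
open import Data.Nat using (ℕ; zero; suc; _+_; _*_; _∸_; _^_; _≤_; _<_; z≤n; s≤s; _<?_; _≤?_; NonZero; >-nonZero)
open import Data.Nat.Properties hiding (_≟_)
open import Data.Nat.Tactic.RingSolver using (solve-∀)
open import Data.Product using (_×_; _,_; ∃-syntax; proj₁; proj₂)
open import Data.Sum using (inj₁; inj₂)
open import Data.Vec.Functional using (foldr; []; _∷_)
open import Function using (_∘_)
open import Function.Definitions using (Injective)
open import Relation.Binary.PropositionalEquality using (_≡_; _≢_; refl; sym; trans; cong; cong₂; subst; module ≡-Reasoning)
open import Relation.Nullary using (¬_; yes; no; contradiction; ⌊_⌋)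
open import Relation.Nullary.Decidable using (_×-dec_)

open import Algebra.Properties.Semiring.Sum +-*-semiring
  using (sum; sum-syntax; sum-remove; sum-cong-≗; ∑-distrib-+; ∑-comm; *-distribˡ-sum; *-distribʳ-sum)

private variable
  n s t : ℕ

-- Sums and counting over finite sets.

⟦_⟧ : Bool → ℕ
⟦ b ⟧ = if b then 1 else 0

⟦∧⟧ : ∀ a b → ⟦ a ∧ b ⟧ ≡ ⟦ a ⟧ * ⟦ b ⟧
⟦∧⟧ true  b = sym (*-identityˡ ⟦ b ⟧)
⟦∧⟧ false b = refl

count : (Fin n → Bool) → ℕ
count A = sum (λ i → ⟦ A i ⟧)

sum-mono : {f g : Fin n → ℕ} → (∀ i → f i ≤ g i) → sum f ≤ sum g
sum-mono {zero}  f≤g = z≤n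
sum-mono {suc n} f≤g = +-mono-≤ (f≤g zero) (sum-mono (f≤g ∘ suc))

sum-const : ∀ n c → ∑[ i < n ] c ≡ n * c
sum-const zero    c = refl
sum-const (suc n) c = cong (c +_) (sum-const n c)

sum-zero : {f : Fin n → ℕ} → (∀ i → f i ≡ 0) → sum f ≡ 0
sum-zero {n} f≡0 = trans (sum-cong-≗ f≡0) (trans (sum-const n 0) (*-zeroʳ n))

-- A separate `g` stands for `f` with its value at `v` erased, so that the lemma serves both the
-- size of a set and its triangle count when `v` is deleted.
sum-split : ∀ v (f g : Fin n → ℕ) → g v ≡ 0 → (∀ x → x ≢ v → g x ≡ f x) → sum f ≡ f v + sum g
sum-split {suc n} v f g gv≡0 g≡f = trans (sum-remove {i = v} f) (cong (f v +_) (sym eq))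
  where
  eq : sum g ≡ ∑[ i < n ] f (punchIn v i)
  eq = trans (sum-remove {i = v} g)
    (cong₂ _+_ gv≡0 (sum-cong-≗ (λ i → g≡f (punchIn v i) (punchInᵢ≢i v i))))

sum-pigeonhole : ∀ k (f : Fin n → ℕ) → n * k < sum f → ∃[ i ] k < f i
sum-pigeonhole {suc n} k f lt with k <? f zero
... | yes k<f₀ = zero , k<f₀
... | no  k≮f₀ with sum-pigeonhole k (f ∘ suc) (+-cancelˡ-< k _ _ (<-≤-trans lt (+-monoˡ-≤ _ (≮⇒≥ k≮f₀))))
...   | i , k<fᵢ = suc i , k<fᵢ

count-≤ : (A : Fin n → Bool) → count A ≤ n
count-≤ {n} A = ≤-trans (sum-mono (λ i → bound (A i))) (≤-reflexive (trans (sum-const n 1) (*-identityʳ n)))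
  where
  bound : ∀ b → ⟦ b ⟧ ≤ 1
  bound true  = ≤-refl
  bound false = z≤n

count-pos : (A : Fin n → Bool) → 0 < count A → ∃[ i ] A i ≡ true
count-pos {n} A pos with sum-pigeonhole 0 (λ i → ⟦ A i ⟧) (subst (_< count A) (sym (*-zeroʳ n)) pos)
... | i , lt with A i in eq
...   | true = i , eq

-- Inclusion-exclusion, checked index by index and kept additive to avoid truncated subtraction.
count-∧ : (A B : Fin n → Bool) → count A + count B ≤ n + count (λ i → A i ∧ B i)
count-∧ {zero}  A B = z≤n
count-∧ {suc n} A B = begin
  (a + x) + (b + y)                             ≡⟨ solve-+ a x b y ⟩
  (a + b) + (x + y)                             ≤⟨ +-mono-≤ (step (A zero) (B zero)) (count-∧ (A ∘ suc) (B ∘ suc)) ⟩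
  (1 + c) + (n + z)                             ≡⟨ solve-+ 1 c n z ⟩
  suc n + (c + z)                               ∎
  where
  open ≤-Reasoning
  a = ⟦ A zero ⟧
  b = ⟦ B zero ⟧
  c = ⟦ A zero ∧ B zero ⟧
  x = count (A ∘ suc)
  y = count (B ∘ suc)
  z = count (λ i → A (suc i) ∧ B (suc i))
  solve-+ : ∀ a x b y → (a + x) + (b + y) ≡ (a + b) + (x + y)
  solve-+ = solve-∀
  step : ∀ a b → ⟦ a ⟧ + ⟦ b ⟧ ≤ 1 + ⟦ a ∧ b ⟧
  step true  b     = ≤-refl
  step false true  = ≤-refl
  step false false = z≤n

infixl 6 _∖_
_∖_ : (Fin n → Bool) → Fin n → Fin n → Bool
(A ∖ v) x = A x ∧ not ⌊ x ≟ v ⌋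

∖-self : (A : Fin n → Bool) → ∀ v → (A ∖ v) v ≡ false
∖-self A v with v ≟ v
... | yes _ = ∧-comm (A v) false
... | no ≢  = contradiction refl ≢

∖-other : (A : Fin n → Bool) → ∀ {v x} → x ≢ v → (A ∖ v) x ≡ A x
∖-other A {v} {x} x≢v with x ≟ v
... | yes x≡v = contradiction x≡v x≢v
... | no _    = ∧-identityʳ (A x)

∖-≢ : (A : Fin n → Bool) → ∀ {v x} → (A ∖ v) x ≡ true → x ≢ v
∖-≢ A {v} eq refl with () ← trans (sym (∖-self A v)) eq

∖-⊆ : (A : Fin n → Bool) → ∀ {v x} → (A ∖ v) x ≡ true → A x ≡ true
∖-⊆ A {v} {x} eq = trans (sym (∖-other A (∖-≢ A eq))) eq

count-∖ : (A : Fin n → Bool) → ∀ {v} → A v ≡ true → count A ≡ suc (count (A ∖ v))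
count-∖ A {v} Av = trans
  (sum-split v _ (λ x → ⟦ (A ∖ v) x ⟧) (cong ⟦_⟧ (∖-self A v)) (λ x x≢v → cong ⟦_⟧ (∖-other A x≢v)))
  (cong (λ b → ⟦ b ⟧ + count (A ∖ v)) Av)

-- Triangles forced by the minimum degree.

Relation : ℕ → Set
Relation n = Fin n → Fin n → Bool

-- Each membership test is grouped with the forward edge of its vertex, so rotating the classes only
-- permutes three conjuncts cyclically.
triangle : (P Q R : Relation n) (A B C : Fin n → Bool) → Fin n → Fin n → Fin n → Bool
triangle P Q R A B C x y z = (A x ∧ P x y) ∧ ((B y ∧ Q y z) ∧ (C z ∧ R z x))

triangles : (P Q R : Relation n) (A B C : Fin n → Bool) → ℕ
triangles {n} P Q R A B C = ∑[ x < n ] ∑[ y < n ] ∑[ z < n ] ⟦ triangle P Q R A B C x y z ⟧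

triangles-rotate : ∀ (P Q R : Relation n) A B C → triangles P Q R A B C ≡ triangles R P Q C A B
triangles-rotate {n} P Q R A B C = begin
  triangles P Q R A B C
    ≡⟨ sum-cong-≗ (λ x → ∑-comm (λ y z → ⟦ triangle P Q R A B C x y z ⟧)) ⟩
  ∑[ x < n ] ∑[ z < n ] ∑[ y < n ] ⟦ triangle P Q R A B C x y z ⟧
    ≡⟨ ∑-comm (λ x z → ∑[ y < n ] ⟦ triangle P Q R A B C x y z ⟧) ⟩
  ∑[ z < n ] ∑[ x < n ] ∑[ y < n ] ⟦ triangle P Q R A B C x y z ⟧
    ≡⟨ sum-cong-≗ (λ z → sum-cong-≗ (λ x → sum-cong-≗ (λ y → cong ⟦_⟧ (rotate (A x ∧ P x y) (B y ∧ Q y z) (C z ∧ R z x))))) ⟩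
  triangles R P Q C A B ∎
  where
  open ≡-Reasoning
  rotate : ∀ p q r → p ∧ (q ∧ r) ≡ r ∧ (p ∧ q)
  rotate p q r = trans (sym (∧-assoc p q r)) (∧-comm (p ∧ q) r)

-- P, Q, R go cyclically between the three classes, so that at each vertex the
-- first summand is the forward degree and the second the backward degree.
record Rich (t : ℕ) (P Q R : Relation n) (A B C : Fin n → Bool) (a b c : ℕ) : Set where
  field
    t≤n   : t ≤ n
    deg₁  : ∀ x → n + t ≤ count (P x) + count (λ z → R z x)
    deg₂  : ∀ y → n + t ≤ count (Q y) + count (λ x → P x y)
    deg₃  : ∀ z → n + t ≤ count (R z) + count (λ y → Q y z)
    -- Additive form of missing at most `t - a` vertices; together with `t≤n` it makes `A` nonempty
    -- once `a` is positive.
    size₁ : n + a ≤ count A + t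
    size₂ : n + b ≤ count B + t
    size₃ : n + c ≤ count C + t

rich-rotate : ∀ {P Q R : Relation n} {A B C a b c} → Rich t P Q R A B C a b c → Rich t R P Q C A B c a b
rich-rotate h = record
  { t≤n = t≤n ; deg₁ = deg₃ ; deg₂ = deg₁ ; deg₃ = deg₂ ; size₁ = size₃ ; size₂ = size₁ ; size₃ = size₂ }
  where open Rich h

-- Degrees are taken in the whole graph, so deleting a vertex of `A` affects only the size bound of
-- `A`, by one.
rich-remove : ∀ {P Q R : Relation n} {A B C a b c v} → A v ≡ true →
  Rich t P Q R A B C (suc a) b c → Rich t P Q R (A ∖ v) B C a b c
rich-remove {n} {t} {A = A} {a = a} {v = v} Av h = record
  { Rich h ; size₁ = ≤-pred (begin
      suc (n + a)              ≡⟨ +-suc n a ⟨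
      n + suc a                ≤⟨ Rich.size₁ h ⟩
      count A + t              ≡⟨ cong (_+ t) (count-∖ A Av) ⟩
      suc (count (A ∖ v) + t)  ∎) }
  where open ≤-Reasoning

-- The forward degree of v is at least that of every w ∈ C, so each edge w → v
-- lies in at least b triangles, and there are at least c such edges.
triangles-at : ∀ {P Q R : Relation n} {A B C a b c v} → Rich t P Q R A B C a b c → A v ≡ true →
  (∀ w → C w ≡ true → count (R w) ≤ count (P v)) →
  b * c ≤ ∑[ y < n ] ∑[ z < n ] ⟦ triangle P Q R A B C v y z ⟧
triangles-at {n} {t} {P} {Q} {R} {A} {B} {C} {a} {b} {c} {v} h Av maximal = begin
  b * c                                                       ≡⟨ *-comm b c ⟩
  c * b                                                       ≤⟨ *-monoˡ-≤ b many ⟩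
  count (λ z → C z ∧ R z v) * b                               ≡⟨ *-distribʳ-sum b (λ z → ⟦ C z ∧ R z v ⟧) ⟩
  ∑[ z < n ] (⟦ C z ∧ R z v ⟧ * b)                            ≤⟨ sum-mono edge ⟩
  ∑[ z < n ] ∑[ y < n ] ⟦ triangle P Q R A B C v y z ⟧        ≡⟨ ∑-comm (λ z y → ⟦ triangle P Q R A B C v y z ⟧) ⟩
  ∑[ y < n ] ∑[ z < n ] ⟦ triangle P Q R A B C v y z ⟧        ∎
  where
  open ≤-Reasoning
  open Rich h
  p = count (P v)
  r = count (λ z → R z v)

  -- The forward degree of `v` is at most `n`, hence its backward degree is at least `t`, and `C`
  -- misses at most `t - c` vertices.
  many : c ≤ count (λ z → C z ∧ R z v)
  many = +-cancelˡ-≤ n _ _ (begin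
    n + c                                ≤⟨ size₃ ⟩
    count C + t                          ≤⟨ +-monoʳ-≤ (count C) (+-cancelˡ-≤ n _ _ (≤-trans (deg₁ v) (+-monoˡ-≤ r (count-≤ (P v))))) ⟩
    count C + r                          ≤⟨ count-∧ C (λ z → R z v) ⟩
    n + count (λ z → C z ∧ R z v)        ∎)

  edge : ∀ z → ⟦ C z ∧ R z v ⟧ * b ≤ ∑[ y < n ] ⟦ triangle P Q R A B C v y z ⟧
  edge z with C z in Cz | R z v
  ... | false | _     = z≤n
  ... | true  | false = z≤n
  ... | true  | true  = begin
    1 * b                                                     ≡⟨ *-identityˡ b ⟩
    b                                                         ≤⟨ +-cancelˡ-≤ (n + n) _ _ bound ⟩
    count (λ y → P v y ∧ (B y ∧ Q y z))                       ≡⟨ sum-cong-≗ (λ y → cong ⟦_⟧ (cong₂ _∧_ (cong (_∧ P v y) (sym Av)) (sym (∧-identityʳ (B y ∧ Q y z))))) ⟩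
    ∑[ y < n ] ⟦ (A v ∧ P v y) ∧ ((B y ∧ Q y z) ∧ true) ⟧     ∎
    where
    q = count (λ y → Q y z)
    bq = count (λ y → B y ∧ Q y z)
    pbq = count (λ y → P v y ∧ (B y ∧ Q y z))
    swap : ∀ x y z → x + (y + z) ≡ y + (x + z)
    swap = solve-∀
    -- By `maximal`, `p` may replace the forward degree of `z` in `deg₃ z`, so `p + q ≥ n + t`.
    -- Intersecting with `B` uses `count-∧` twice, at a cost of `n` each time.
    bound : n + n + b ≤ n + n + pbq
    bound = begin
      n + n + b          ≡⟨ +-assoc n n b ⟩
      n + (n + b)        ≤⟨ +-monoʳ-≤ n size₂ ⟩
      n + (count B + t)  ≡⟨ swap n (count B) t ⟩
      count B + (n + t)  ≤⟨ +-monoʳ-≤ (count B) (≤-trans (deg₃ z) (+-monoˡ-≤ q (maximal z Cz))) ⟩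
      count B + (p + q)  ≡⟨ swap (count B) p q ⟩
      p + (count B + q)  ≤⟨ +-monoʳ-≤ p (count-∧ B (λ y → Q y z)) ⟩
      p + (n + bq)       ≡⟨ swap p n bq ⟩
      n + (p + bq)       ≤⟨ +-monoʳ-≤ n (count-∧ (P v) (λ y → B y ∧ Q y z)) ⟩
      n + (n + pbq)      ≡⟨ +-assoc n n pbq ⟨
      n + n + pbq        ∎

triangles-remove : ∀ (P Q R : Relation n) A B C v → triangles P Q R A B C ≡
  (∑[ y < n ] ∑[ z < n ] ⟦ triangle P Q R A B C v y z ⟧) + triangles P Q R (A ∖ v) B C
triangles-remove P Q R A B C v = sum-split v _ _
  (sum-zero (λ y → sum-zero (λ z → cong (λ b → ⟦ (b ∧ P v y) ∧ ((B y ∧ Q y z) ∧ (C z ∧ R z v)) ⟧) (∖-self A v))))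
  (λ x x≢v → sum-cong-≗ (λ y → sum-cong-≗ (λ z →
    cong (λ b → ⟦ (b ∧ P x y) ∧ ((B y ∧ Q y z) ∧ (C z ∧ R z x)) ⟧) (∖-other A x≢v))))

-- The induction measure `a + b + c` is invariant under rotation, so the induction hypothesis
-- survives a restart in another class.
TriangleBound : (n t k : ℕ) → Set
TriangleBound n t k = ∀ {P Q R : Relation n} {A B C a b c} → a + b + c ≤ k →
  Rich t P Q R A B C a b c → a * (b * c) ≤ triangles P Q R A B C

-- If some w ∈ C beats the forward degree of v, restart from w with the roles of
-- the classes rotated: forward degrees increase, and d bounds the remaining climb.
climb : ∀ {k} → TriangleBound n t k → ∀ d {P Q R : Relation n} {A B C a b c} →
  a + suc b + suc c ≤ k → Rich t P Q R A B C (suc a) (suc b) (suc c) →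
  ∀ v → A v ≡ true → n ≤ count (P v) + d → suc a * (suc b * suc c) ≤ triangles P Q R A B C
climb {n} {t} ih d {P} {Q} {R} {A} {B} {C} {a} {b} {c} le h v Av fuel
  with any? (λ w → (C w ≟ᵇ true) ×-dec (count (P v) <? count (R w)))
climb ih d {P} {Q} {R} {A} {B} {C} {a} {b} {c} le h v Av fuel | no none = begin
  suc b * suc c + a * (suc b * suc c)
    ≤⟨ +-mono-≤ (triangles-at h Av (λ w Cw → ≮⇒≥ (λ lt → none (w , Cw , lt)))) (ih le (rich-remove Av h)) ⟩
  _ + triangles P Q R (A ∖ v) B C  ≡⟨ triangles-remove P Q R A B C v ⟨
  triangles P Q R A B C            ∎
  where open ≤-Reasoning
-- Without fuel the forward degree of `v` is already `n`, which no vertex exceeds.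
climb ih zero {P} {R = R} le h v Av fuel | yes (w , Cw , lt) =
  contradiction (<-≤-trans lt (count-≤ (R w))) (≤⇒≯ (subst (_ ≤_) (+-identityʳ _) fuel))
climb {n} ih (suc d) {P} {Q} {R} {A} {B} {C} {a} {b} {c} le h v Av fuel | yes (w , Cw , lt) = begin
  suc a * (suc b * suc c)  ≡⟨ rotate (suc a) (suc b) (suc c) ⟩
  suc c * (suc a * suc b)  ≤⟨ climb ih d (≤-trans (≤-reflexive (sym (shift a b c))) le) (rich-rotate h) w Cw
                                (≤-trans (subst (n ≤_) (+-suc _ d) fuel) (+-monoˡ-≤ d lt)) ⟩
  triangles R P Q C A B    ≡⟨ triangles-rotate P Q R A B C ⟨
  triangles P Q R A B C    ∎
  where
  open ≤-Reasoning
  rotate : ∀ x y z → x * (y * z) ≡ z * (x * y)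
  rotate = solve-∀
  shift : ∀ a b c → a + suc b + suc c ≡ c + suc a + suc b
  shift = solve-∀

triangle-bound : ∀ k → TriangleBound n t k
triangle-bound k {a = zero} le h = z≤n
triangle-bound k {a = suc a} {zero} le h = ≤-trans (≤-reflexive (*-zeroʳ a)) z≤n
triangle-bound k {a = suc a} {suc b} {zero} le h =
  ≤-trans (≤-reflexive (trans (cong (suc a *_) (*-zeroʳ b)) (*-zeroʳ a))) z≤n
triangle-bound {n} {t} (suc k) {A = A} {a = suc a} {suc b} {suc c} (s≤s le) h =
  -- Any vertex of `A` can start the climb, since fuel `n` covers every forward degree.
  climb (triangle-bound k) n le h (proj₁ start) (proj₂ start) (m≤n+m n _)
  where
  open Rich h
  nonempty : 0 < count A
  nonempty = +-cancelʳ-< t 0 _ (<-≤-trans (s≤s t≤n) (≤-trans (m≤m+n (suc n) a) (≤-trans (≤-reflexive (sym (+-suc n a))) size₁)))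
  start = count-pos A nonempty

-- Sums over pairs and the power mean inequality.

sum-+ : ∀ m (f : Fin (m + n) → ℕ) → sum f ≡ ∑[ i < m ] f (i ↑ˡ n) + ∑[ j < n ] f (m ↑ʳ j)
sum-+ zero    f = refl
sum-+ (suc m) f = trans (cong (f zero +_) (sum-+ m (f ∘ suc))) (sym (+-assoc (f zero) _ _))

sum-combine : ∀ m n (f : Fin (m * n) → ℕ) → sum f ≡ ∑[ i < m ] ∑[ j < n ] f (combine i j)
sum-combine zero    n f = refl
sum-combine (suc m) n f = trans (sum-+ n f) (cong (∑[ j < n ] f (j ↑ˡ (m * n)) +_) (sum-combine m n (f ∘ (n ↑ʳ_))))

-- Lets the pairs in V₁ × V₂ act as a single vertex class of size `n * n`.
sum-pairs : ∀ m n (f : Fin m → Fin n → ℕ) →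
  ∑[ k < m * n ] f (quotient n k) (remainder {m} n k) ≡ ∑[ i < m ] ∑[ j < n ] f i j
sum-pairs m n f = trans (sum-combine m n _)
  (sum-cong-≗ (λ i → sum-cong-≗ (λ j → cong (λ ij → f (proj₁ ij) (proj₂ ij)) (remQuot-combine i j))))

-- With `b = a + x` and `d = c + y`, the two sides differ by `x * y`.
rearrangement : ∀ {a b c d} → a ≤ b → c ≤ d → a * d + b * c ≤ a * c + b * d
rearrangement {a} {c = c} a≤b c≤d with m≤n⇒∃[o]m+o≡n a≤b | m≤n⇒∃[o]m+o≡n c≤d
... | x , refl | y , refl = ≤-trans (m≤m+n _ (x * y)) (≤-reflexive (eq a c x y))
  where
  eq : ∀ a c x y → a * (c + y) + (a + x) * c + x * y ≡ a * c + (a + x) * (c + y)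
  eq = solve-∀

-- Similar ordering of `f` and `g` enters as the rearrangement inequality for each pair of indices,
-- which is the form in which the induction meets the cross terms.
chebyshev : (f g : Fin n → ℕ) → (∀ i j → f i * g j + f j * g i ≤ f i * g i + f j * g j) →
  sum f * sum g ≤ n * ∑[ i < n ] (f i * g i)
chebyshev {zero}  f g similar = z≤n
chebyshev {suc n} f g similar = begin
  (x + F) * (y + G)                      ≡⟨ expand x F y G ⟩
  x * y + (x * G + F * y) + F * G        ≤⟨ +-mono-≤ (+-monoʳ-≤ (x * y) cross) (chebyshev (f ∘ suc) (g ∘ suc) (λ i j → similar (suc i) (suc j))) ⟩
  x * y + (n * (x * y) + FG) + n * FG    ≡⟨ collect (x * y) FG n ⟩
  suc n * (x * y + FG)                   ∎
  where
  open ≤-Reasoning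
  x = f zero
  y = g zero
  F = sum (f ∘ suc)
  G = sum (g ∘ suc)
  FG = ∑[ i < n ] (f (suc i) * g (suc i))
  expand : ∀ x F y G → (x + F) * (y + G) ≡ x * y + (x * G + F * y) + F * G
  expand = solve-∀
  collect : ∀ p q n → p + (n * p + q) + n * q ≡ suc n * (p + q)
  collect = solve-∀
  cross : x * G + F * y ≤ n * (x * y) + FG
  cross = begin
    x * G + F * y                                         ≡⟨ cong₂ _+_ (*-distribˡ-sum x (g ∘ suc)) (*-distribʳ-sum y (f ∘ suc)) ⟩
    ∑[ i < n ] (x * g (suc i)) + ∑[ i < n ] (f (suc i) * y)  ≡⟨ ∑-distrib-+ (λ i → x * g (suc i)) (λ i → f (suc i) * y) ⟨
    ∑[ i < n ] (x * g (suc i) + f (suc i) * y)            ≤⟨ sum-mono (λ i → similar zero (suc i)) ⟩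
    ∑[ i < n ] (x * y + f (suc i) * g (suc i))            ≡⟨ ∑-distrib-+ (λ _ → x * y) (λ i → f (suc i) * g (suc i)) ⟩
    ∑[ i < n ] (x * y) + FG                               ≡⟨ cong (_+ FG) (sum-const n (x * y)) ⟩
    n * (x * y) + FG                                      ∎

-- Induction on the exponent: `f` and its power are similarly ordered, so Chebyshev's inequality
-- supplies each further factor.
power-mean : ∀ s (f : Fin n → ℕ) → sum f ^ suc s ≤ n ^ s * ∑[ i < n ] (f i ^ suc s)
power-mean zero f = ≤-reflexive (trans (*-identityʳ _)
  (trans (sum-cong-≗ (λ i → sym (*-identityʳ (f i)))) (sym (*-identityˡ _))))
power-mean {n} (suc s) f = begin
  sum f * sum f ^ suc s                            ≤⟨ *-monoʳ-≤ (sum f) (power-mean s f) ⟩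
  sum f * (n ^ s * ∑[ i < n ] (f i ^ suc s))       ≡⟨ swap (sum f) (n ^ s) _ ⟩
  n ^ s * (sum f * ∑[ i < n ] (f i ^ suc s))       ≤⟨ *-monoʳ-≤ (n ^ s) (chebyshev f (λ i → f i ^ suc s) similar) ⟩
  n ^ s * (n * ∑[ i < n ] (f i ^ suc (suc s)))     ≡⟨ assoc (n ^ s) n _ ⟩
  n ^ suc s * ∑[ i < n ] (f i ^ suc (suc s))       ∎
  where
  open ≤-Reasoning
  swap : ∀ x y z → x * (y * z) ≡ y * (x * z)
  swap = solve-∀
  assoc : ∀ x y z → x * (y * z) ≡ y * x * z
  assoc = solve-∀
  similar : ∀ i j → f i * f j ^ suc s + f j * f i ^ suc s ≤ f i * f i ^ suc s + f j * f j ^ suc s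
  similar i j with ≤-total (f i) (f j)
  ... | inj₁ le = rearrangement le (^-monoˡ-≤ (suc s) le)
  ... | inj₂ ge = ≤-trans (≤-reflexive (+-comm (f i * f j ^ suc s) _))
        (≤-trans (rearrangement ge (^-monoˡ-≤ (suc s) ge)) (≤-reflexive (+-comm (f j * f j ^ suc s) _)))

-- The Kővári-Sós-Turán argument and the box theorem.

every : (Fin s → Bool) → Bool
every = foldr _∧_ true

every-lookup : (p : Fin s → Bool) → every p ≡ true → ∀ i → p i ≡ true
every-lookup {suc s} p eq i with p zero in p₀
every-lookup {suc s} p eq zero    | true = p₀
every-lookup {suc s} p eq (suc i) | true = every-lookup (p ∘ suc) eq i

every-tabulate : (p : Fin s → Bool) → (∀ i → p i ≡ true) → every p ≡ true
every-tabulate {zero}  p all = refl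
every-tabulate {suc s} p all = cong₂ _∧_ (all zero) (every-tabulate (p ∘ suc) (all ∘ suc))

⟦⟧-mono : ∀ {a b} → (a ≡ true → b ≡ true) → ⟦ a ⟧ ≤ ⟦ b ⟧
⟦⟧-mono {false} imp = z≤n
⟦⟧-mono {true}  imp = ≤-reflexive (cong ⟦_⟧ (sym (imp refl)))

⟦⟧-pos : ∀ m {b} → 0 < m * ⟦ b ⟧ → b ≡ true
⟦⟧-pos m {true}  pos = refl
⟦⟧-pos m {false} pos = contradiction (≤-trans pos (≤-reflexive (*-zeroʳ m))) (λ ())

∷-injective : ∀ {A : Set} {z : A} {g : Fin s → A} → Injective _≡_ _≡_ g → (∀ i → g i ≢ z) → Injective _≡_ _≡_ (z ∷ g)
∷-injective inj g≢z {zero}  {zero}  eq = refl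
∷-injective inj g≢z {zero}  {suc j} eq = contradiction (sym eq) (g≢z j)
∷-injective inj g≢z {suc i} {zero}  eq = contradiction eq (g≢z i)
∷-injective inj g≢z {suc i} {suc j} eq = cong suc (inj eq)

-- The g i are chosen one at a time: averaging gives a z such that the edges at z
-- carry at least 1/n of the weight, and z is then deleted to keep g injective.
common-neighbours : ∀ s {N n} (w : Fin N → ℕ) (B : Fin N → Fin n → Bool) k →
  n ^ s * k < ∑[ x < N ] (w x * (count (B x) ∸ s) ^ s) →
  ∃[ g ] Injective _≡_ _≡_ g × k < ∑[ x < N ] (w x * ⟦ every {s} (λ i → B x (g i)) ⟧)
common-neighbours zero {N} w B k lt = [] , (λ {i} → λ { {()} }) , subst (_< ∑[ x < N ] (w x * 1)) (*-identityˡ k) lt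
common-neighbours (suc s) {N} {n} w B k lt = z ∷ g , ∷-injective g-inj g≢z , <-≤-trans k< (sum-mono shrink)
  where
  open ≤-Reasoning
  rest : Fin n → Fin N → ℕ
  rest z x = (count (B x ∖ z) ∸ s) ^ s

  -- One factor is enlarged to `count (B x)`, the number of choices of `z`. The others are
  -- unchanged: deleting `z` lowers the count by one, just as the subtrahend drops from `suc s` to
  -- `s`.
  expand : ∀ x → w x * (count (B x) ∸ suc s) ^ suc s ≤ ∑[ z < n ] (w x * ⟦ B x z ⟧ * rest z x)
  expand x = begin
    w x * (d ∸ suc s) ^ suc s                           ≤⟨ *-monoʳ-≤ (w x) (*-monoˡ-≤ ((d ∸ suc s) ^ s) (m∸n≤m d (suc s))) ⟩
    w x * (d * (d ∸ suc s) ^ s)                         ≡⟨ cong (w x *_) (*-distribʳ-sum ((d ∸ suc s) ^ s) (λ z → ⟦ B x z ⟧)) ⟩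
    w x * ∑[ z < n ] (⟦ B x z ⟧ * (d ∸ suc s) ^ s)      ≡⟨ *-distribˡ-sum (w x) (λ z → ⟦ B x z ⟧ * (d ∸ suc s) ^ s) ⟩
    ∑[ z < n ] (w x * (⟦ B x z ⟧ * (d ∸ suc s) ^ s))    ≡⟨ sum-cong-≗ (λ z → trans (cong (w x *_) (term z)) (sym (*-assoc (w x) ⟦ B x z ⟧ (rest z x)))) ⟩
    ∑[ z < n ] (w x * ⟦ B x z ⟧ * rest z x)             ∎
    where
    d = count (B x)
    term : ∀ z → ⟦ B x z ⟧ * (d ∸ suc s) ^ s ≡ ⟦ B x z ⟧ * rest z x
    term z with B x z in eq
    ... | false = refl
    ... | true  = cong (λ e → 1 * (e ∸ suc s) ^ s) (count-∖ (B x) eq)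

  pigeonhole = sum-pigeonhole (n ^ s * k) (λ z → ∑[ x < N ] (w x * ⟦ B x z ⟧ * rest z x)) (begin-strict
    n * (n ^ s * k)                                              ≡⟨ *-assoc n (n ^ s) k ⟨
    n ^ suc s * k                                                <⟨ lt ⟩
    ∑[ x < N ] (w x * (count (B x) ∸ suc s) ^ suc s)             ≤⟨ sum-mono expand ⟩
    ∑[ x < N ] ∑[ z < n ] (w x * ⟦ B x z ⟧ * rest z x)           ≡⟨ ∑-comm (λ x z → w x * ⟦ B x z ⟧ * rest z x) ⟩
    ∑[ z < n ] ∑[ x < N ] (w x * ⟦ B x z ⟧ * rest z x)           ∎)
  z = proj₁ pigeonhole

  ih = common-neighbours s (λ x → w x * ⟦ B x z ⟧) (λ x → B x ∖ z) k (proj₂ pigeonhole)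
  g = proj₁ ih
  g-inj = proj₁ (proj₂ ih)
  k< = proj₂ (proj₂ ih)

  -- The remaining weight is positive, so some `x` has every `g i` among its neighbours other than
  -- `z`; this is why `g` avoids `z`.
  witness = sum-pigeonhole 0 (λ x → w x * ⟦ B x z ⟧ * ⟦ every (λ i → (B x ∖ z) (g i)) ⟧)
    (≤-<-trans (≤-reflexive (*-zeroʳ N)) (≤-<-trans z≤n k<))

  g≢z : ∀ i → g i ≢ z
  g≢z i = ∖-≢ (B (proj₁ witness)) (every-lookup (λ i → (B (proj₁ witness) ∖ z) (g i)) (⟦⟧-pos (w (proj₁ witness) * ⟦ B (proj₁ witness) z ⟧) (proj₂ witness)) i)

  shrink : ∀ x → w x * ⟦ B x z ⟧ * ⟦ every (λ i → (B x ∖ z) (g i)) ⟧ ≤ w x * ⟦ every (λ i → B x ((z ∷ g) i)) ⟧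
  shrink x = begin
    w x * ⟦ B x z ⟧ * ⟦ every (λ i → (B x ∖ z) (g i)) ⟧
      ≤⟨ *-monoʳ-≤ (w x * ⟦ B x z ⟧) (⟦⟧-mono (λ eq → every-tabulate (λ i → B x (g i)) (λ i → ∖-⊆ (B x) (every-lookup (λ i → (B x ∖ z) (g i)) eq i)))) ⟩
    w x * ⟦ B x z ⟧ * ⟦ every (λ i → B x (g i)) ⟧    ≡⟨ *-assoc (w x) _ _ ⟩
    w x * (⟦ B x z ⟧ * ⟦ every (λ i → B x (g i)) ⟧)  ≡⟨ cong (w x *_) (⟦∧⟧ (B x z) _) ⟨
    w x * ⟦ every (λ i → B x ((z ∷ g) i)) ⟧          ∎

-- Convexity: `power-mean` for the degrees reduced by `suc s` gives the sum of powers needed by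
-- `common-neighbours` with unit weights. The reduction costs at most `N * suc s` edges.
kővári-sós-turán : ∀ s {N n} (B : Fin N → Fin n → Bool) k →
  N ^ s * (n ^ suc s * k) < (∑[ x < N ] count (B x) ∸ N * suc s) ^ suc s →
  ∃[ g ] Injective _≡_ _≡_ g × k < count (λ x → every {suc s} (λ i → B x (g i)))
kővári-sós-turán s {N} {n} B k lt =
  let g , g-inj , k< = common-neighbours (suc s) (λ _ → 1) B k large
  in  g , g-inj , <-≤-trans k< (≤-reflexive (sum-cong-≗ (λ x → *-identityˡ ⟦ every (λ i → B x (g i)) ⟧)))
  where
  open ≤-Reasoning
  d = λ x → count (B x) ∸ suc s

  excess : ∑[ x < N ] count (B x) ∸ N * suc s ≤ sum d
  excess = m≤n+o⇒m∸n≤o _ (N * suc s) (begin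
    ∑[ x < N ] count (B x)        ≤⟨ sum-mono (λ x → m≤n+m∸n (count (B x)) (suc s)) ⟩
    ∑[ x < N ] (suc s + d x)      ≡⟨ ∑-distrib-+ (λ _ → suc s) d ⟩
    ∑[ x < N ] suc s + sum d      ≡⟨ cong (_+ sum d) (sum-const N (suc s)) ⟩
    N * suc s + sum d             ∎)

  large : n ^ suc s * k < ∑[ x < N ] (1 * d x ^ suc s)
  large = *-cancelˡ-< (N ^ s) _ _ (begin-strict
    N ^ s * (n ^ suc s * k)                             <⟨ lt ⟩
    (∑[ x < N ] count (B x) ∸ N * suc s) ^ suc s        ≤⟨ ^-monoˡ-≤ (suc s) excess ⟩
    sum d ^ suc s                                       ≤⟨ power-mean s d ⟩
    N ^ s * ∑[ x < N ] (d x ^ suc s)                    ≡⟨ cong (N ^ s *_) (sum-cong-≗ (λ x → *-identityˡ (d x ^ suc s))) ⟨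
    N ^ s * ∑[ x < N ] (1 * d x ^ suc s)                ∎)

choose : ∀ s (A : Fin n → Bool) → s ≤ count A → ∃[ h ] Injective _≡_ _≡_ h × (∀ (i : Fin s) → A (h i) ≡ true)
choose zero    A le = [] , (λ {i} → λ { {()} }) , λ ()
choose (suc s) A le with count-pos A (<-≤-trans (s≤s z≤n) le)
... | v , Av with choose s (A ∖ v) (≤-pred (≤-trans le (≤-reflexive (count-∖ A Av))))
...   | h , h-inj , h∈A = v ∷ h , ∷-injective h-inj (λ i → ∖-≢ A (h∈A i)) ,
          λ { zero → Av ; (suc i) → ∖-⊆ A (h∈A i) }

-- First apply Kővári–Sós–Turán to (V₁ × V₂, V₃), then to V₁ and V₂ joined by the
-- pairs lying over all of the chosen vertices of V₃.
erdős-box : ∀ s (H : Fin n → Fin n → Fin n → Bool) k →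
  (n * n) ^ s * (n ^ suc s * k) < (∑[ x < n ] ∑[ y < n ] count (H x y) ∸ n * n * suc s) ^ suc s →
  n ^ s * (n ^ suc s * s) < (suc k ∸ n * suc s) ^ suc s →
  ∃[ h ] ∃[ g ] ∃[ f ] Injective _≡_ _≡_ h × Injective _≡_ _≡_ g × Injective _≡_ _≡_ f ×
    (∀ (i j l : Fin (suc s)) → H (h i) (g j) (f l) ≡ true)
erdős-box {n} s H k lt₁ lt₂ =
  let f , f-inj , k< = kővári-sós-turán s (λ xy → H (quotient n xy) (remainder {n} n xy)) k
        (<-≤-trans lt₁ (^-monoˡ-≤ (suc s) (∸-monoˡ-≤ (n * n * suc s)
          (≤-reflexive (sym (sum-pairs n n (λ x y → count (H x y))))))))
      -- More than `s` common neighbours means at least `suc s` of them, from which `choose` takes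
      -- `h`.
      g , g-inj , s< = kővári-sós-turán s (λ x y → every (λ l → H x y (f l))) s
        (<-≤-trans lt₂ (^-monoˡ-≤ (suc s) (∸-monoˡ-≤ (n * suc s)
          (≤-trans k< (≤-reflexive (sum-pairs n n (λ x y → ⟦ every (λ l → H x y (f l)) ⟧)))))))
      h , h-inj , h∈ = choose (suc s) (λ x → every (λ j → every (λ l → H x (g j) (f l)))) s<
  in  h , g , f , h-inj , g-inj , f-inj , λ i j l →
        every-lookup (λ l → H (h i) (g j) (f l)) (every-lookup (λ j → every (λ l → H (h i) (g j) (f l))) (h∈ i) j) l

-- Powers, integer roots and the numerical estimates.

^-distribʳ-* : ∀ k m n → (m * n) ^ k ≡ m ^ k * n ^ k
^-distribʳ-* zero    m n = refl
^-distribʳ-* (suc k) m n = trans (cong (m * n *_) (^-distribʳ-* k m n)) ([m*n]*[o*p]≡[m*o]*[n*p] m n (m ^ k) (n ^ k))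

^-cancelʳ-≤ : ∀ k .{{_ : NonZero k}} {m n} → m ^ k ≤ n ^ k → m ≤ n
^-cancelʳ-≤ k le = ≮⇒≥ (λ n<m → <⇒≱ (^-monoˡ-< k n<m) le)

^-cancelʳ-< : ∀ k {m n} → m ^ k < n ^ k → m < n
^-cancelʳ-< k lt = ≰⇒> (λ n≤m → <⇒≱ lt (^-monoˡ-≤ k n≤m))

-- Raising `M` by one raises the integer root by at most one.
root : ∀ s M → ∃[ r ] r ^ suc s ≤ M × M < suc r ^ suc s
root s zero    = 0 , z≤n , m^n>0 1 (suc s)
root s (suc M) with root s M
... | r , lo , hi with suc r ^ suc s ≤? suc M
...   | yes le = suc r , le , ≤-<-trans hi (^-monoˡ-< (suc s) ≤-refl)
...   | no  gt = r , m≤n⇒m≤1+n lo , ≰⇒> gt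

-- Provides one `t` for all vertices: the least value passing the power condition is below every
-- excess `degree G v ∸ n`, so no minimum over vertices is taken.
least : ∀ (f : ℕ → ℕ) M m → M ≤ f m → ∃[ t ] M ≤ f t × (∀ m → M ≤ f m → t ≤ m)
least f M m M≤f with M ≤? f 0
... | yes le = 0 , le , λ _ _ → z≤n
least f M zero    M≤f | no gt = contradiction M≤f gt
least f M (suc m) M≤f | no gt with least (f ∘ suc) M m M≤f
... | t , le , min = suc t , le , λ { zero le → contradiction le gt ; (suc m) le → s≤s (min m le) }

-- The gain (1 + 1/q)^(2S²) beats the loss (1 + 1/(q+1))^S because q (q + 2) < (q + 1)².
gain : ∀ s q → 1 ≤ q → let S = suc s ; D = suc q ; e = S * S in
  q ^ (3 * e) * (D ^ e * suc D ^ S) < D ^ (3 * e) * (q ^ e * D ^ S)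
gain s q 1≤q = begin-strict
  q ^ (3 * e) * (D ^ e * suc D ^ S)                       ≡⟨ cong (_* (D ^ e * suc D ^ S)) (cube q) ⟩
  q ^ e * (q ^ e * (q ^ S * q ^ (s * S))) * (D ^ e * suc D ^ S)   ≡⟨ shuffle₁ (q ^ e) (q ^ S) (q ^ (s * S)) (D ^ e) (suc D ^ S) ⟩
  q ^ e * D ^ e * (q ^ e * q ^ (s * S) * (q ^ S * suc D ^ S))  ≡⟨ cong (λ x → q ^ e * D ^ e * (q ^ e * q ^ (s * S) * x)) (^-distribʳ-* S q (suc D)) ⟨
  -- Of the `3 * e` factors `q`, `e` are common to both sides, `S` are paired with `suc D`, and the
  -- rest are rounded up to `D`.
  q ^ e * D ^ e * (q ^ e * q ^ (s * S) * (q * suc D) ^ S)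
    ≤⟨ *-monoʳ-≤ (q ^ e * D ^ e) (*-monoˡ-≤ ((q * suc D) ^ S) (*-mono-≤ (^-monoˡ-≤ e (n≤1+n q)) (^-monoˡ-≤ (s * S) (n≤1+n q)))) ⟩
  q ^ e * D ^ e * (D ^ e * D ^ (s * S) * (q * suc D) ^ S)
    <⟨ *-monoʳ-< (q ^ e * D ^ e) {{pos₁}} (*-monoʳ-< (D ^ e * D ^ (s * S)) {{pos₂}} (^-monoˡ-< S (≤-reflexive (square q)))) ⟩
  q ^ e * D ^ e * (D ^ e * D ^ (s * S) * (D * D) ^ S)     ≡⟨ cong (λ x → q ^ e * D ^ e * (D ^ e * D ^ (s * S) * x)) (^-distribʳ-* S D D) ⟩
  q ^ e * D ^ e * (D ^ e * D ^ (s * S) * (D ^ S * D ^ S)) ≡⟨ shuffle₂ (q ^ e) (D ^ S) (D ^ (s * S)) (D ^ e) ⟩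
  D ^ e * (D ^ e * (D ^ S * D ^ (s * S))) * (q ^ e * D ^ S) ≡⟨ cong (_* (q ^ e * D ^ S)) (cube D) ⟨
  D ^ (3 * e) * (q ^ e * D ^ S)                           ∎
  where
  open ≤-Reasoning
  S = suc s
  D = suc q
  e = S * S
  instance
    q≢0 : NonZero q
    q≢0 = >-nonZero 1≤q
  pos₁ : NonZero (q ^ e * D ^ e)
  pos₁ = m*n≢0 (q ^ e) (D ^ e) {{m^n≢0 q e}} {{m^n≢0 D e}}
  pos₂ : NonZero (D ^ e * D ^ (s * S))
  pos₂ = m*n≢0 (D ^ e) (D ^ (s * S)) {{m^n≢0 D e}} {{m^n≢0 D (s * S)}}
  cube : ∀ x → x ^ (3 * e) ≡ x ^ e * (x ^ e * (x ^ S * x ^ (s * S)))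
  cube x = trans (^-distribˡ-+-* x e (e + (e + 0))) (cong (x ^ e *_) (trans (^-distribˡ-+-* x e (e + 0))
    (cong (x ^ e *_) (trans (cong (x ^_) (+-identityʳ e)) (^-distribˡ-+-* x S (s * S))))))
  square : ∀ q → suc (q * suc (suc q)) ≡ suc q * suc q
  square = solve-∀
  shuffle₁ : ∀ a b c d f → a * (a * (b * c)) * (d * f) ≡ a * d * (a * c * (b * f))
  shuffle₁ = solve-∀
  shuffle₂ : ∀ a b c d → a * d * (d * c * (b * b)) ≡ d * (d * (b * c)) * (a * b)
  shuffle₂ = solve-∀

-- Chosen so that the terms subtracted in the two Kővári-Sós-Turán steps are at most a `1 / suc q`
-- fraction of `t ^ 3` and of the root `r` respectively.
threshold : ℕ → ℕ → ℕ
threshold s q = (suc q * suc s) ^ (suc s * suc s)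

-- k = n S + r, where r is the integer part of (s n^(2S-1))^(1/S) with S = s + 1.
box-parameter : ∀ s p q n t .{{_ : NonZero s}} → 1 ≤ p → 1 ≤ q → threshold s q ≤ n →
  (q + p) ^ (3 * (suc s * suc s)) * s * n ^ (3 * (suc s * suc s) ∸ 1) ≤ (q * t) ^ (3 * (suc s * suc s)) →
  ∃[ k ] (n * n) ^ s * (n ^ suc s * k) < (t ^ 3 ∸ n * n * suc s) ^ suc s ×
         n ^ s * (n ^ suc s * s) < (suc k ∸ n * suc s) ^ suc s
box-parameter s@(suc s′) p q n t 1≤p 1≤q n₀≤n hyp =
  -- `W` is the least choice for the second inequality: `suc W ∸ n * S` equals `suc r`, the first
  -- number whose `S`-th power exceeds `M`.
  W , ≰⇒> absurd , subst (λ x → M < x ^ S)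
    (sym (trans (cong (_∸ n * S) (sym (+-suc (n * S) r))) (m+n∸m≡n (n * S) (suc r)))) r-hi
  where
  open ≤-Reasoning
  S = suc s
  D = suc q
  e = S * S
  K = 3 * e
  M = n ^ s * (n ^ S * s)
  r = proj₁ (root s M)
  r-lo = proj₁ (proj₂ (root s M))
  r-hi = proj₂ (proj₂ (root s M))
  W = n * S + r
  T = t ^ 3
  U = T ∸ n * n * S
  X = s * n ^ (K ∸ 1)

  instance
    q≢0 : NonZero q
    q≢0 = >-nonZero 1≤q
    n≢0 : NonZero n
    n≢0 = >-nonZero (<-≤-trans (m^n>0 (D * S) e) n₀≤n)
    X≢0 : NonZero X
    X≢0 = m*n≢0 s (n ^ (K ∸ 1)) {{_}} {{m^n≢0 n (K ∸ 1)}}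

  -- As `p ≥ 1`, the hypothesis may be weakened to `ε = 1 / q`; the factor 3 in `K` turns `t` into
  -- `T`.
  hyp′ : D ^ K * X ≤ q ^ K * T ^ e
  hyp′ = begin
    D ^ K * X                            ≤⟨ *-monoˡ-≤ X (^-monoˡ-≤ K (≤-trans (≤-reflexive (+-comm 1 q)) (+-monoʳ-≤ q 1≤p))) ⟩
    (q + p) ^ K * X                      ≡⟨ *-assoc ((q + p) ^ K) s (n ^ (K ∸ 1)) ⟨
    (q + p) ^ K * s * n ^ (K ∸ 1)        ≤⟨ hyp ⟩
    (q * t) ^ K                          ≡⟨ ^-distribʳ-* K q t ⟩
    q ^ K * t ^ K                        ≡⟨ cong (q ^ K *_) (^-*-assoc t 3 e) ⟨
    q ^ K * T ^ e                        ∎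

  -- Compare `e`-th powers: `(D * S) ^ e` is at most one factor `n`, and `2 * e + 1 ≤ K - 1` because
  -- `e ≥ 4`.
  DSnn≤T : D * (n * n * S) ≤ T
  DSnn≤T = ^-cancelʳ-≤ e (*-cancelˡ-≤ (q ^ K) {{m^n≢0 q K}} (≤-trans (*-mono-≤ (^-monoˡ-≤ K (n≤1+n q)) (begin
    (D * (n * n * S)) ^ e            ≡⟨ cong (_^ e) (regroup D n S) ⟩
    (D * S * n ^ 2) ^ e              ≡⟨ ^-distribʳ-* e (D * S) (n ^ 2) ⟩
    (D * S) ^ e * (n ^ 2) ^ e        ≡⟨ cong ((D * S) ^ e *_) (^-*-assoc n 2 e) ⟩
    (D * S) ^ e * n ^ (2 * e)        ≤⟨ *-monoˡ-≤ (n ^ (2 * e)) n₀≤n ⟩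
    n ^ suc (2 * e)                  ≤⟨ ^-monoʳ-≤ n (≤-trans (m≤m+n (suc (2 * e)) _) (≤-reflexive (exponent s′))) ⟩
    n ^ (K ∸ 1)                      ≤⟨ m≤n*m (n ^ (K ∸ 1)) s ⟩
    X                                ∎)) hyp′))
    where
    regroup : ∀ d n s → d * (n * n * s) ≡ d * s * (n * (n * 1))
    regroup = solve-∀
    exponent : ∀ s → suc (2 * (suc (suc s) * suc (suc s))) + (s * s + 4 * s + 2) ≡ 3 * (suc (suc s) * suc (suc s)) ∸ 1
    exponent s = cong (_∸ 1) (expand s)
      where
      expand : ∀ s → suc (suc (2 * (suc (suc s) * suc (suc s))) + (s * s + 4 * s + 2)) ≡ 3 * (suc (suc s) * suc (suc s))
      expand = solve-∀

  -- Losing at most `T / D` leaves a fraction `q / D` of `T`, since `D = q + 1`.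
  qT≤DU : q * T ≤ D * U
  qT≤DU = +-cancelˡ-≤ T _ _ (begin
    D * T                          ≤⟨ *-monoʳ-≤ D (m≤n+m∸n T (n * n * S)) ⟩
    D * (n * n * S + U)            ≡⟨ *-distribˡ-+ D (n * n * S) U ⟩
    D * (n * n * S) + D * U        ≤⟨ +-monoˡ-≤ (D * U) DSnn≤T ⟩
    T + D * U                      ∎)

  -- Compare `S`-th powers with `suc r`: `(D * S) ^ S ≤ n` and `n * n ^ S ≤ M`.
  DSn≤r : D * (n * S) ≤ r
  DSn≤r = ≤-pred (^-cancelʳ-< S (≤-<-trans (begin
    (D * (n * S)) ^ S            ≡⟨ cong (_^ S) (regroup D n S) ⟩
    (D * S * n) ^ S              ≡⟨ ^-distribʳ-* S (D * S) n ⟩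
    (D * S) ^ S * n ^ S          ≤⟨ *-monoˡ-≤ (n ^ S) (≤-trans (^-monoʳ-≤ (D * S) (m≤m*n S S)) n₀≤n) ⟩
    n * n ^ S                    ≤⟨ *-mono-≤ (m≤m*n n (n ^ s′) {{m^n≢0 n s′}}) (m≤m*n (n ^ S) s) ⟩
    M                            ∎) r-hi))
    where
    regroup : ∀ d n s → d * (n * s) ≡ d * s * n
    regroup = solve-∀

  DW≤r : D * W ≤ suc D * r
  DW≤r = begin
    D * (n * S + r)          ≡⟨ *-distribˡ-+ D (n * S) r ⟩
    D * (n * S) + D * r      ≤⟨ +-monoˡ-≤ (D * r) DSn≤r ⟩
    suc D * r                ∎

  N : ℕ
  N = (n * n) ^ s * n ^ S

  -- The exponent `3 * e - 1` of the hypothesis arises here: `N ^ S` contributes `(3 * S - 2) * S`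
  -- and `M` contributes `2 * S - 1`.
  NM≡X : N ^ S * M ≡ X
  NM≡X = begin-equality
    N ^ S * (n ^ s * (n ^ S * s))              ≡⟨ cong (λ x → (x * n ^ S) ^ S * M) (trans (^-distribʳ-* s n n) (sym (^-distribˡ-+-* n s s))) ⟩
    (n ^ (s + s) * n ^ S) ^ S * M              ≡⟨ cong (λ x → x ^ S * M) (^-distribˡ-+-* n (s + s) S) ⟨
    (n ^ (s + s + S)) ^ S * M                  ≡⟨ cong (_* M) (^-*-assoc n (s + s + S) S) ⟩
    n ^ ((s + s + S) * S) * M                  ≡⟨ regroup (n ^ ((s + s + S) * S)) (n ^ s) (n ^ S) s ⟩
    s * (n ^ ((s + s + S) * S) * (n ^ s * n ^ S))  ≡⟨ cong (λ x → s * (n ^ ((s + s + S) * S) * x)) (^-distribˡ-+-* n s S) ⟨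
    s * (n ^ ((s + s + S) * S) * n ^ (s + S))  ≡⟨ cong (s *_) (^-distribˡ-+-* n ((s + s + S) * S) (s + S)) ⟨
    s * n ^ ((s + s + S) * S + (s + S))        ≡⟨ cong (λ x → s * n ^ (x ∸ 1)) (exponent s) ⟩
    X                                          ∎
    where
    regroup : ∀ a b c d → a * (b * (c * d)) ≡ d * (a * (b * c))
    regroup = solve-∀
    exponent : ∀ s → suc ((s + s + suc s) * suc s + (s + suc s)) ≡ 3 * (suc s * suc s)
    exponent = solve-∀

  -- Were the first inequality false, its `S`-th power with `qT≤DU`, `DW≤r` and `r-lo` would bound
  -- `T ^ e` by a multiple of `X` that `gain` shows to be too small for `hyp′`.
  absurd : ¬ (U ^ S ≤ (n * n) ^ s * (n ^ S * W))
  absurd U≤ = <⇒≱ (gain s q 1≤q) (*-cancelʳ-≤ _ _ X (begin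
    D ^ K * (q ^ e * D ^ S) * X                      ≡⟨ shuffle₁ (D ^ K) (q ^ e * D ^ S) X ⟩
    D ^ K * X * (q ^ e * D ^ S)                      ≤⟨ *-monoˡ-≤ (q ^ e * D ^ S) hyp′ ⟩
    q ^ K * T ^ e * (q ^ e * D ^ S)                  ≡⟨ shuffle₂ (q ^ K) (T ^ e) (q ^ e) (D ^ S) ⟩
    q ^ K * (q ^ e * T ^ e * D ^ S)                  ≤⟨ *-monoʳ-≤ (q ^ K) main ⟩
    q ^ K * (D ^ e * suc D ^ S * X)                  ≡⟨ *-assoc (q ^ K) (D ^ e * suc D ^ S) X ⟨
    q ^ K * (D ^ e * suc D ^ S) * X                  ∎))
    where
    shuffle₁ : ∀ a b c → a * b * c ≡ a * c * b
    shuffle₁ = solve-∀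
    shuffle₂ : ∀ a b c d → a * b * (c * d) ≡ a * (c * b * d)
    shuffle₂ = solve-∀
    shuffle₃ : ∀ a b c d → a * (b * c) * d ≡ a * b * (d * c)
    shuffle₃ = solve-∀
    shuffle₄ : ∀ a b c d → a * b * (c * d) ≡ a * c * (b * d)
    shuffle₄ = solve-∀
    main : q ^ e * T ^ e * D ^ S ≤ D ^ e * suc D ^ S * X
    main = begin
      q ^ e * T ^ e * D ^ S                    ≡⟨ cong (_* D ^ S) (^-distribʳ-* e q T) ⟨
      (q * T) ^ e * D ^ S                      ≤⟨ *-monoˡ-≤ (D ^ S) (^-monoˡ-≤ e qT≤DU) ⟩
      (D * U) ^ e * D ^ S                      ≡⟨ cong (_* D ^ S) (^-distribʳ-* e D U) ⟩
      D ^ e * U ^ e * D ^ S                    ≡⟨ cong (λ x → D ^ e * x * D ^ S) (^-*-assoc U S S) ⟨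
      D ^ e * (U ^ S) ^ S * D ^ S              ≤⟨ *-monoˡ-≤ (D ^ S) (*-monoʳ-≤ (D ^ e) (^-monoˡ-≤ S (≤-trans U≤ (≤-reflexive (sym (*-assoc ((n * n) ^ s) (n ^ S) W)))))) ⟩
      D ^ e * (N * W) ^ S * D ^ S              ≡⟨ cong (λ x → D ^ e * x * D ^ S) (^-distribʳ-* S N W) ⟩
      D ^ e * (N ^ S * W ^ S) * D ^ S          ≡⟨ shuffle₃ (D ^ e) (N ^ S) (W ^ S) (D ^ S) ⟩
      D ^ e * N ^ S * (D ^ S * W ^ S)          ≡⟨ cong (D ^ e * N ^ S *_) (^-distribʳ-* S D W) ⟨
      D ^ e * N ^ S * (D * W) ^ S              ≤⟨ *-monoʳ-≤ (D ^ e * N ^ S) (^-monoˡ-≤ S DW≤r) ⟩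
      D ^ e * N ^ S * (suc D * r) ^ S          ≡⟨ cong (D ^ e * N ^ S *_) (^-distribʳ-* S (suc D) r) ⟩
      D ^ e * N ^ S * (suc D ^ S * r ^ S)      ≤⟨ *-monoʳ-≤ (D ^ e * N ^ S) (*-monoʳ-≤ (suc D ^ S) r-lo) ⟩
      D ^ e * N ^ S * (suc D ^ S * M)          ≡⟨ shuffle₄ (D ^ e) (N ^ S) (suc D ^ S) M ⟩
      D ^ e * suc D ^ S * (N ^ S * M)          ≡⟨ cong (D ^ e * suc D ^ S *_) NM≡X ⟩
      D ^ e * suc D ^ S * X                    ∎

-- From the graph to its triangles, and from a box back to K₃(s).

countFin≡count : ∀ n (A : Fin n → Bool) → countFin n A ≡ count A
countFin≡count zero    A = refl
countFin≡count (suc n) A = cong (⟦ A zero ⟧ +_) (countFin≡count n (A ∘ suc))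

between : TripartiteGraph n → Fin 3 → Fin 3 → Relation n
between G i j x y = adj G (i , x) (j , y)

module _ (G : TripartiteGraph n) where
  private
    E = between G

  degree-sum : ∀ i x → degree G (i , x) ≡ count (E i 0F x) + (count (E i 1F x) + count (E i 2F x))
  degree-sum i x = cong₂ _+_ (countFin≡count n (E i 0F x)) (cong₂ _+_ (countFin≡count n (E i 1F x))
    (trans (+-identityʳ _) (countFin≡count n (E i 2F x))))

  count-intra : ∀ i x → count (E i i x) ≡ 0
  count-intra i x = sum-zero (λ y → cong ⟦_⟧ (noIntra G i x y))

  count-sym : ∀ i j x → count (E i j x) ≡ count (λ y → E j i y x)
  count-sym i j x = sum-cong-≗ (λ y → cong ⟦_⟧ (adj-sym G (i , x) (j , y)))

  -- Splits the degree along the cycle 0 → 1 → 2 → 0, with symmetry turning the backward edges into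
  -- the direction used by `Rich`.
  degree₀ : ∀ x → degree G (0F , x) ≡ count (E 0F 1F x) + count (λ z → E 2F 0F z x)
  degree₀ x = trans (degree-sum 0F x) (cong₂ _+_ (count-intra 0F x) (cong (count (E 0F 1F x) +_) (count-sym 0F 2F x)))

  degree₁ : ∀ y → degree G (1F , y) ≡ count (E 1F 2F y) + count (λ x → E 0F 1F x y)
  degree₁ y = trans (degree-sum 1F y) (trans (cong₂ _+_ (count-sym 1F 0F y)
    (cong (_+ count (E 1F 2F y)) (count-intra 1F y))) (+-comm _ (count (E 1F 2F y))))

  degree₂ : ∀ z → degree G (2F , z) ≡ count (E 2F 0F z) + count (λ y → E 1F 2F y z)
  degree₂ z = trans (degree-sum 2F z) (cong (count (E 2F 0F z) +_)
    (trans (cong₂ _+_ (count-sym 2F 1F z) (count-intra 2F z)) (+-identityʳ _)))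

  isTriangle : Fin n → Fin n → Fin n → Bool
  isTriangle = triangle (E 0F 1F) (E 1F 2F) (E 2F 0F) (λ _ → true) (λ _ → true) (λ _ → true)

  cube-triangles : t ≤ n → (∀ v → n + t ≤ degree G v) →
    t ^ 3 ≤ ∑[ x < n ] ∑[ y < n ] count (isTriangle x y)
  cube-triangles {t} t≤n deg = ≤-trans (≤-reflexive (cong (λ x → t * (t * x)) (*-identityʳ t)))
    (triangle-bound (t + t + t) ≤-refl (record
      { t≤n   = t≤n
      ; deg₁  = λ x → ≤-trans (deg (0F , x)) (≤-reflexive (degree₀ x))
      ; deg₂  = λ y → ≤-trans (deg (1F , y)) (≤-reflexive (degree₁ y))
      ; deg₃  = λ z → ≤-trans (deg (2F , z)) (≤-reflexive (degree₂ z))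
      ; size₁ = full ; size₂ = full ; size₃ = full }))
    where
    -- A full class misses nothing, which permits `a = b = c = t`.
    full : n + t ≤ count {n} (λ _ → true) + t
    full = ≤-reflexive (cong (_+ t) (sym (trans (sum-const n 1) (*-identityʳ n))))

  -- A vertex sees only two classes; this yields the bound `t ≤ n` required by `Rich`.
  excess-≤ : ∀ x → degree G (0F , x) ∸ n ≤ n
  excess-≤ x = m≤n+o⇒m∸n≤o _ n (≤-trans (≤-reflexive (degree₀ x)) (+-mono-≤ (count-≤ (E 0F 1F x)) (count-≤ (λ z → E 2F 0F z x))))

  triangle-edges : ∀ {x y z} → isTriangle x y z ≡ true →
    E 0F 1F x y ≡ true × E 1F 2F y z ≡ true × E 2F 0F z x ≡ true
  triangle-edges {x} {y} {z} eq with E 0F 1F x y | E 1F 2F y z | E 2F 0F z x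
  ... | true | true | true = refl , refl , refl

  box⇒K3 : ∀ s (h g f : Fin (suc s) → Fin n) → Injective _≡_ _≡_ h → Injective _≡_ _≡_ g → Injective _≡_ _≡_ f →
    (∀ i j l → isTriangle (h i) (g j) (f l) ≡ true) → ContainsK3 (suc s) G
  box⇒K3 s h g f h-inj g-inj f-inj box = embed , embed-inj , edge
    where
    part : Fin 3 → Fin (suc s) → Fin n
    part 0F = h
    part 1F = g
    part 2F = f

    part-inj : ∀ a → Injective _≡_ _≡_ (part a)
    part-inj 0F = h-inj
    part-inj 1F = g-inj
    part-inj 2F = f-inj

    embed : Fin 3 × Fin (suc s) → Vtx n
    embed (a , i) = a , part a i

    embed-inj : Injective _≡_ _≡_ embed
    embed-inj {a , i} {b , j} eq with refl ← cong proj₁ eq = cong (a ,_) (part-inj a (cong proj₂ eq))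

    -- An edge is read off from a triangle whose third index is `zero`, available because each side
    -- of the box has size `suc s`.
    e₀₁ : ∀ i j → E 0F 1F (h i) (g j) ≡ true
    e₀₁ i j = proj₁ (triangle-edges (box i j zero))
    e₁₂ : ∀ j l → E 1F 2F (g j) (f l) ≡ true
    e₁₂ j l = proj₁ (proj₂ (triangle-edges (box zero j l)))
    e₂₀ : ∀ l i → E 2F 0F (f l) (h i) ≡ true
    e₂₀ l i = proj₂ (proj₂ (triangle-edges (box i zero l)))

    edge : ∀ a b i j → a ≢ b → adj G (embed (a , i)) (embed (b , j)) ≡ true
    edge 0F 0F i j a≢b = contradiction refl a≢b
    edge 0F 1F i j _   = e₀₁ i j
    edge 0F 2F i j _   = trans (adj-sym G _ _) (e₂₀ j i)
    edge 1F 0F i j _   = trans (adj-sym G _ _) (e₀₁ j i)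
    edge 1F 1F i j a≢b = contradiction refl a≢b
    edge 1F 2F i j _   = e₁₂ i j
    edge 2F 0F i j _   = e₂₀ i j
    edge 2F 1F i j _   = trans (adj-sym G _ _) (e₁₂ j i)
    edge 2F 2F i j a≢b = contradiction refl a≢b

-- Real roots are avoided by taking `ε = p / q`, raising the degree condition to the power
-- `3 * (s * s)` and clearing `q`. A real `ε` is covered by any positive rational below it, and
-- `n ≤ degree G v` keeps the truncated subtraction exact.
theorem1p3 : (s : ℕ) → 2 ≤ s → (p q : ℕ) → 1 ≤ p → 1 ≤ q →
    ∃[ n₀ ] ((n : ℕ) → n₀ ≤ n → (G : TripartiteGraph n) →
    ((v : Vtx n) → (n ≤ degree G v) ×
    ((q + p) ^ (3 * (s * s)) * (s ∸ 1) * n ^ (3 * (s * s) ∸ 1)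
    ≤ (q * (degree G v ∸ n)) ^ (3 * (s * s)))) →
    ContainsK3 s G)
theorem1p3 (suc s@(suc _)) (s≤s _) p q 1≤p 1≤q = threshold s q , contains
  where
  K = 3 * (suc s * suc s)
  M : ℕ → ℕ
  M n = (q + p) ^ K * s * n ^ (K ∸ 1)

  contains : (n : ℕ) → threshold s q ≤ n → (G : TripartiteGraph n) →
    ((v : Vtx n) → (n ≤ degree G v) × (M n ≤ (q * (degree G v ∸ n)) ^ K)) → ContainsK3 (suc s) G
  -- The search for `t` starts from the excess of the vertex `(0F , zero)`, so `n` has to be
  -- positive.
  contains zero    n₀≤0 G deg = contradiction n₀≤0 (<⇒≱ (m^n>0 (suc q * suc s) (suc s * suc s)))
  contains n@(suc _) n₀≤n G deg =
    let t , M≤ , t-least = least (λ t → (q * t) ^ K) (M n) _ (proj₂ (deg (0F , zero)))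
        t≤ v = t-least (degree G v ∸ n) (proj₂ (deg v))
        k , lt₁ , lt₂ = box-parameter s p q n t 1≤p 1≤q n₀≤n M≤
        many = cube-triangles G (≤-trans (t≤ (0F , zero)) (excess-≤ G zero))
          (λ v → ≤-trans (+-monoʳ-≤ n (t≤ v)) (≤-reflexive (m+[n∸m]≡n (proj₁ (deg v)))))
        h , g , f , h-inj , g-inj , f-inj , box = erdős-box s (isTriangle G) k
          (<-≤-trans lt₁ (^-monoˡ-≤ (suc s) (∸-monoˡ-≤ (n * n * suc s) many))) lt₂
    in  box⇒K3 G s h g f h-inj g-inj f-inj box
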